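{- There is a tight proper coloring $F:{}^{\omega}\omega\to\omega$ that does not depend on finitely many coordinates.
   Context: ${}^{\omega}\omega$ is the set of functions from $\omega$ to $\omega$. Write $x\perp y$ if $x(i)\ne y(i)$ for all $i\in\omega$. $F:{}^{\omega}\omega\to\omega$ is a proper coloring if $F(x)\ne F(y)$ whenever $x\perp y$. A proper coloring $F$ is tight if for all $x\in{}^{\omega}\omega$ and $\beta\in\omega$ with $F(x)\ne\beta$ there is $y\in{}^{\omega}\omega$ with $y\perp x$ and $F(y)=\beta$. $F$ depends on finitely many coordinates if there is a finite set $S\subset\omega$ such that $F(x)=F(y)$ for all $x,y\in{}^{\omega}\omega$ with $x(i)=y(i)$ for every $i\in S$. -}

module Defs where

open import Data.List using (List)
open import Data.List.Membership.Propositional using (_∈_)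
open import Data.Nat using (ℕ)
open import Data.Product using (_×_; ∃-syntax; Σ-syntax)
open import Function.Bundles using (_⟶ₛ_; _⟨$⟩_)
open import Relation.Binary.PropositionalEquality
  using (_≡_; _≢_; setoid; _→-setoid_)

Seq : Set
Seq = ℕ → ℕ

-- Sequences are compared pointwise: without function extensionality this,
-- rather than _≡_ on ℕ → ℕ, is equality in ω^ω, so a function on ω^ω is a
-- setoid map.
Coloring : Set
Coloring = (ℕ →-setoid ℕ) ⟶ₛ setoid ℕ

infix 4 _⟂_

_⟂_ : Seq → Seq → Set
x ⟂ y = ∀ i → x i ≢ y i

IsProper : Coloring → Set
IsProper F = ∀ (x y : Seq) → x ⟂ y → F ⟨$⟩ x ≢ F ⟨$⟩ y

IsTight : Coloring → Set
IsTight F = ∀ (x : Seq) (β : ℕ) → F ⟨$⟩ x ≢ β →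
  ∃[ y ] (y ⟂ x × F ⟨$⟩ y ≡ β)

-- The list S stands for the finite set of its entries.
DependsOnFinitelyMany : Coloring → Set
DependsOnFinitelyMany F = Σ[ S ∈ List ℕ ] (∀ (x y : Seq) →
  (∀ i → i ∈ S → x i ≡ y i) → F ⟨$⟩ x ≡ F ⟨$⟩ y)

{-# OPTIONS --safe #-}
-- Split each natural number n into its half ⌊n/2⌋ and its parity, so that ω is
-- a disjoint union of pairs.  For odd m, ω^m is then a disjoint union of
-- m-dimensional cubes, and each cube is the union of its even and its odd
-- points.  Two points of the same cube and of the same parity differ in an
-- even number of coordinates, so they agree somewhere, and each of these half
-- cubes is a maximal intersecting family: inside a given cube one can avoid
-- any point x, with either parity if x is outside the cube, and with the
-- parity opposite to that of x if x is inside.  Hence the half cubes are the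
-- classes of a tight proper coloring.  To involve infinitely many coordinates,
-- let ⌊x 0/2⌋ decide how many coordinates are used.
module Submission where

open import Defs
open import Data.Empty using (⊥-elim)
open import Data.List.Extrema.Nat using (max; xs≤max)
open import Data.List.Membership.Propositional using (_∈_)
import Data.List.Relation.Unary.All as All
open import Data.Nat
  using (ℕ; zero; suc; _*_; _<_; ⌊_/2⌋; parity; s≤s; z<s; s<s; s<s⁻¹)
open import Data.Nat.Induction using (<-rec)
open import Data.Nat.Properties
  using (_≟_; anyUpTo?; ⌊n/2⌋<n; ≤-refl; ≤-<-trans; <⇒≢; m≤m+n; m≤n⇒m≤1+n)
open import Data.Parity.Base as ℙ using (Parity; 0ℙ; 1ℙ; _⁻¹)
open import Data.Parity.Properties as ℙ
  using (p≢p⁻¹; ⁻¹-involutive; +-homo-+; *-homo-*)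
open import Data.Product using (_×_; _,_; ∃-syntax; Σ-syntax; proj₁)
open import Function.Base using (_∘_; const)
open import Relation.Binary.PropositionalEquality
open import Relation.Nullary using (¬_; yes; no; ¬?)
open import Relation.Nullary.Decidable using (decidable-stable)

-- Numbers as pairs of a half and a parity

join : ℕ → Parity → ℕ
join zero    0ℙ = 0
join zero    1ℙ = 1
join (suc b) p  = suc (suc (join b p))

⌊join/2⌋ : ∀ b p → ⌊ join b p /2⌋ ≡ b
⌊join/2⌋ zero    0ℙ = refl
⌊join/2⌋ zero    1ℙ = refl
⌊join/2⌋ (suc b) p  = cong suc (⌊join/2⌋ b p)

parity-join : ∀ b p → parity (join b p) ≡ p
parity-join zero    0ℙ = refl
parity-join zero    1ℙ = refl
parity-join (suc b) p  = parity-join b p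

join-⌊/2⌋-parity : ∀ n → join ⌊ n /2⌋ (parity n) ≡ n
join-⌊/2⌋-parity 0             = refl
join-⌊/2⌋-parity 1             = refl
join-⌊/2⌋-parity (suc (suc n)) = cong (suc ∘ suc) (join-⌊/2⌋-parity n)

join-injectiveˡ : ∀ {b c p q} → join b p ≡ join c q → b ≡ c
join-injectiveˡ {b} {c} {p} {q} eq =
  trans (sym (⌊join/2⌋ b p)) (trans (cong ⌊_/2⌋ eq) (⌊join/2⌋ c q))

join-injectiveʳ : ∀ {b c p q} → join b p ≡ join c q → p ≡ q
join-injectiveʳ {b} {c} {p} {q} eq =
  trans (sym (parity-join b p)) (trans (cong parity eq) (parity-join c q))

parity-2* : ∀ n → parity (2 * n) ≡ 0ℙ
parity-2* n = *-homo-* 2 n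

-- Bijections from ω^2 and ω^(n+1) to ω

-- pair a b + 1 = 2^a (2b + 1).
pair : ℕ → ℕ → ℕ
pair zero    b = join b 0ℙ
pair (suc a) b = join (pair a b) 1ℙ

pair-injective : ∀ a c {b d} → pair a b ≡ pair c d → a ≡ c × b ≡ d
pair-injective zero    zero    eq = refl , join-injectiveˡ eq
pair-injective zero    (suc c) eq with () ← join-injectiveʳ eq
pair-injective (suc a) zero    eq with () ← join-injectiveʳ eq
pair-injective (suc a) (suc c) eq
  with refl , b≡d ← pair-injective a c (join-injectiveˡ eq) = refl , b≡d

-- Strong induction: an even number ends the descent with `a = 0`, an odd one passes to its half.
pair-surjective : ∀ n → ∃[ a ] ∃[ b ] pair a b ≡ n
pair-surjective = <-rec _ step
  where
  step : ∀ n → (∀ {m} → m < n → ∃[ a ] ∃[ b ] pair a b ≡ m) →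
         ∃[ a ] ∃[ b ] pair a b ≡ n
  step zero    _   = 0 , 0 , refl
  step (suc n) rec with parity (suc n) | join-⌊/2⌋-parity (suc n)
  ... | 0ℙ | eq = 0 , ⌊ suc n /2⌋ , eq
  ... | 1ℙ | eq with a , b , pab ← rec (⌊n/2⌋<n n) =
    suc a , b , trans (cong (λ m → join m 1ℙ) pab) eq

-- The code of the n + 1 entries y 0, …, y n.
code : ℕ → Seq → ℕ
code zero    y = y 0
code (suc n) y = pair (y 0) (code n (y ∘ suc))

code-cong : ∀ n {y z} → (∀ {i} → i < suc n → y i ≡ z i) → code n y ≡ code n z
code-cong zero    eq = eq z<s
code-cong (suc n) eq = cong₂ pair (eq z<s) (code-cong n (eq ∘ s<s))

code-injective : ∀ n {y z} → code n y ≡ code n z → ∀ {i} → i < suc n → y i ≡ z i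
code-injective zero    eq {zero}  _   = eq
code-injective zero    eq {suc i} i<1 with () ← s<s⁻¹ i<1
code-injective (suc n) {y} {z} eq {i} i<n
  with y₀≡z₀ , rest ← pair-injective (y 0) (z 0) eq | i
... | zero   = y₀≡z₀
... | suc i′ = code-injective n rest (s<s⁻¹ i<n)

infixr 5 _∷_

_∷_ : ℕ → Seq → Seq
(a ∷ y) zero    = a
(a ∷ y) (suc i) = y i

code-surjective : ∀ n c → ∃[ y ] code n y ≡ c
code-surjective zero    c = const c , refl
code-surjective (suc n) c
  with a , r , eq ← pair-surjective c
  with y , eq′ ← code-surjective n r =
  a ∷ y , trans (cong (pair a) eq′) eq

-- Sums of parities

sum : ℕ → (ℕ → Parity) → Parity
sum zero    p = 0ℙ
sum (suc n) p = p 0 ℙ.+ sum n (p ∘ suc)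

sum-cong : ∀ n {p q} → (∀ {i} → i < n → p i ≡ q i) → sum n p ≡ sum n q
sum-cong zero    eq = refl
sum-cong (suc n) eq = cong₂ ℙ._+_ (eq z<s) (sum-cong n (eq ∘ s<s))

⁻¹-+ : ∀ p q → p ⁻¹ ℙ.+ q ≡ (p ℙ.+ q) ⁻¹
⁻¹-+ 0ℙ q = refl
⁻¹-+ 1ℙ q = sym (⁻¹-involutive q)

+-⁻¹ : ∀ p q → p ℙ.+ q ⁻¹ ≡ (p ℙ.+ q) ⁻¹
+-⁻¹ 0ℙ q = refl
+-⁻¹ 1ℙ q = refl

⁻¹-transfer : ∀ a b s → a ⁻¹ ℙ.+ (b ℙ.+ s) ≡ b ⁻¹ ℙ.+ (a ℙ.+ s)
⁻¹-transfer 0ℙ 0ℙ s = refl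
⁻¹-transfer 0ℙ 1ℙ s = ⁻¹-involutive s
⁻¹-transfer 1ℙ 0ℙ s = sym (⁻¹-involutive s)
⁻¹-transfer 1ℙ 1ℙ s = refl

-- Each flip adds `1ℙ`. For odd `n` the flips together invert the sum, hence the cubes of odd
-- dimension.
sum-⁻¹ : ∀ n p → sum n (_⁻¹ ∘ p) ≡ parity n ℙ.+ sum n p
sum-⁻¹ zero    p = refl
sum-⁻¹ (suc n) p = begin
  p 0 ⁻¹ ℙ.+ sum n (_⁻¹ ∘ p ∘ suc)
    ≡⟨ cong (p 0 ⁻¹ ℙ.+_) (sum-⁻¹ n (p ∘ suc)) ⟩
  p 0 ⁻¹ ℙ.+ (parity n ℙ.+ sum n (p ∘ suc))
    ≡⟨ ⁻¹-transfer (p 0) (parity n) _ ⟩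
  parity n ⁻¹ ℙ.+ sum (suc n) p
    ≡⟨ cong (ℙ._+ sum (suc n) p) (+-homo-+ 1 n) ⟨
  parity (suc n) ℙ.+ sum (suc n) p ∎
  where open ≡-Reasoning

toggle : ℕ → (ℕ → Parity) → ℕ → Parity
toggle zero    p zero    = p zero ⁻¹
toggle zero    p (suc i) = p (suc i)
toggle (suc j) p zero    = p zero
toggle (suc j) p (suc i) = toggle j (p ∘ suc) i

toggle-≢ : ∀ j p i → i ≢ j → toggle j p i ≡ p i
toggle-≢ zero    p zero    i≢j = ⊥-elim (i≢j refl)
toggle-≢ zero    p (suc i) i≢j = refl
toggle-≢ (suc j) p zero    i≢j = refl
toggle-≢ (suc j) p (suc i) i≢j = toggle-≢ j (p ∘ suc) i (i≢j ∘ cong suc)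

sum-toggle : ∀ n j p → j < n → sum n (toggle j p) ≡ sum n p ⁻¹
sum-toggle (suc n) zero    p _   = ⁻¹-+ (p 0) _
sum-toggle (suc n) (suc j) p j<n =
  trans (cong (p 0 ℙ.+_) (sum-toggle n j (p ∘ suc) (s<s⁻¹ j<n))) (+-⁻¹ (p 0) _)

≢⇒≡⁻¹ : ∀ {p q} → p ≢ q → p ≡ q ⁻¹
≢⇒≡⁻¹ {0ℙ} {0ℙ} p≢q = ⊥-elim (p≢q refl)
≢⇒≡⁻¹ {0ℙ} {1ℙ} p≢q = refl
≢⇒≡⁻¹ {1ℙ} {0ℙ} p≢q = refl
≢⇒≡⁻¹ {1ℙ} {1ℙ} p≢q = ⊥-elim (p≢q refl)

-- The coloring

-- The half cubes on the coordinates 0, …, n.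
halfCube : ℕ → Seq → ℕ
halfCube n x = join (code n (⌊_/2⌋ ∘ x)) (sum (suc n) (parity ∘ x))

halfCube-cong : ∀ n {x y} → (∀ {i} → i < suc n → x i ≡ y i) →
                halfCube n x ≡ halfCube n y
halfCube-cong n eq =
  cong₂ join (code-cong n (cong ⌊_/2⌋ ∘ eq)) (sum-cong (suc n) (cong parity ∘ eq))

-- The index of the last coordinate used: even, so that the number of
-- coordinates is odd, and positive, so that the colors encode k.
last : ℕ → ℕ
last k = suc (suc (2 * k))

parity-suc-last : ∀ k → parity (suc (last k)) ≡ 1ℙ
parity-suc-last k = trans (+-homo-+ 1 (2 * k)) (cong _⁻¹ (parity-2* k))

color : Seq → ℕ
color x = halfCube (last ⌊ x 0 /2⌋) x

color-cong : ∀ {x y} → (∀ i → x i ≡ y i) → color x ≡ color y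
color-cong {x} {y} x≗y =
  trans (cong (λ a → halfCube (last ⌊ a /2⌋) x) (x≗y 0))
        (halfCube-cong (last ⌊ y 0 /2⌋) (λ {i} _ → x≗y i))

coloring : Coloring
coloring = record { to = color ; cong = color-cong }

-- Properness

⌊/2⌋-≡⇒parity-⁻¹ : ∀ {m n} → ⌊ m /2⌋ ≡ ⌊ n /2⌋ → m ≢ n → parity n ≡ parity m ⁻¹
⌊/2⌋-≡⇒parity-⁻¹ {m} {n} halves m≢n = ≢⇒≡⁻¹ λ parities → m≢n (begin
  m                       ≡⟨ join-⌊/2⌋-parity m ⟨
  join ⌊ m /2⌋ (parity m) ≡⟨ cong₂ join halves (sym parities) ⟩
  join ⌊ n /2⌋ (parity n) ≡⟨ join-⌊/2⌋-parity n ⟩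
  n                       ∎)
  where open ≡-Reasoning

-- Equal codes place both points in one cube, where `x ⟂ y` forces opposite parities at each of the
-- oddly many coordinates, hence opposite sums.
halfCube-proper : ∀ n → parity (suc n) ≡ 1ℙ → ∀ {x y} → x ⟂ y →
                  halfCube n x ≢ halfCube n y
halfCube-proper n odd {x} {y} x⟂y eq = p≢p⁻¹ (sum (suc n) (parity ∘ x)) (begin
  sum (suc n) (parity ∘ x)         ≡⟨ join-injectiveʳ eq ⟩
  sum (suc n) (parity ∘ y)
    ≡⟨ sum-cong (suc n) (λ {i} i<n → ⌊/2⌋-≡⇒parity-⁻¹ (halves i<n) (x⟂y i)) ⟩
  sum (suc n) (_⁻¹ ∘ parity ∘ x)   ≡⟨ sum-⁻¹ (suc n) (parity ∘ x) ⟩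
  parity (suc n) ℙ.+ sum (suc n) (parity ∘ x)
    ≡⟨ cong (ℙ._+ sum (suc n) (parity ∘ x)) odd ⟩
  sum (suc n) (parity ∘ x) ⁻¹      ∎)
  where
  open ≡-Reasoning
  halves : ∀ {i} → i < suc n → ⌊ x i /2⌋ ≡ ⌊ y i /2⌋
  halves = code-injective n (join-injectiveˡ eq)

color-proper : IsProper coloring
color-proper x y x⟂y eq =
  halfCube-proper (last k) (parity-suc-last k) x⟂y
    (trans eq (cong (λ m → halfCube (last m) y) (sym k≡l)))
  where
  k = ⌊ x 0 /2⌋
  l = ⌊ y 0 /2⌋
  -- Since `last` is positive, each code unfolds to a `pair` whose first entry fixes the dimension.
  k≡l : k ≡ l
  k≡l = proj₁ (pair-injective k l (join-injectiveˡ eq))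

-- Tightness

joinSeq : Seq → (ℕ → Parity) → Seq
joinSeq b p i = join (b i) (p i)

halfCube-joinSeq : ∀ n b p → halfCube n (joinSeq b p) ≡ join (code n b) (sum (suc n) p)
halfCube-joinSeq n b p =
  cong₂ join (code-cong n (λ {i} _ → ⌊join/2⌋ (b i) (p i)))
             (sum-cong (suc n) (λ {i} _ → parity-join (b i) (p i)))

-- Only `b 0` fixes the dimension, so changing parities never leaves the cube.
color-joinSeq : ∀ b p → let n = last (b 0) in
                color (joinSeq b p) ≡ join (code n b) (sum (suc n) p)
color-joinSeq b p =
  trans (cong (λ k → halfCube (last k) (joinSeq b p)) (⌊join/2⌋ (b 0) (p 0)))
        (halfCube-joinSeq (last (b 0)) b p)

join-≢ : ∀ b m → join b (parity m ⁻¹) ≢ m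
join-≢ b m eq = p≢p⁻¹ (parity m)
  (trans (cong parity (sym eq)) (parity-join b (parity m ⁻¹)))

color-tight : IsTight coloring
color-tight x β Fx≢β
  -- The half of `β` is read as the code of a cube: `k` is its first entry and fixes the dimension,
  -- `r` codes the other entries.
  with k , r , kr≡ ← pair-surjective ⌊ β /2⌋
  with b′ , b′≡ ← code-surjective (suc (2 * k)) r =
  avoid (sum (suc n) (parity ∘ x) ℙ.≟ parity β)
  where
  n = last k

  b : Seq
  b = k ∷ b′

  opposite : ℕ → Parity
  opposite = _⁻¹ ∘ parity ∘ x

  sum-opposite : sum (suc n) opposite ≡ sum (suc n) (parity ∘ x) ⁻¹
  sum-opposite = trans (sum-⁻¹ (suc n) (parity ∘ x))
    (cong (ℙ._+ sum (suc n) (parity ∘ x)) (parity-suc-last k))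

  code-b : code n b ≡ ⌊ β /2⌋
  code-b = trans (cong (pair k) b′≡) kr≡

  color≡β : ∀ p → sum (suc n) p ≡ parity β → color (joinSeq b p) ≡ β
  color≡β p eq =
    trans (color-joinSeq b p) (trans (cong₂ join code-b eq) (join-⌊/2⌋-parity β))

  avoid : _ → ∃[ y ] (y ⟂ x × color y ≡ β)
  -- Opposite parities avoid `x` whatever the halves are, and oddly many flips give the sum wanted
  -- here.
  avoid (no  sum≢) = joinSeq b opposite , (λ i → join-≢ (b i) (x i)) ,
    color≡β opposite (trans sum-opposite (sym (≢⇒≡⁻¹ (sum≢ ∘ sym))))
  -- Now one parity has to be flipped back, which is safe at a coordinate where the half of `x`
  -- differs from that of the cube.
  avoid (yes sum≡) with anyUpTo? (λ i → ¬? (⌊ x i /2⌋ ≟ b i)) (suc n)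
  -- Without such a coordinate, `x` lies in the half cube of `β` itself.
  ... | no same = ⊥-elim (Fx≢β (begin
      color x                       ≡⟨ cong (λ m → halfCube (last m) x) (halves z<s) ⟩
      join (code n (⌊_/2⌋ ∘ x)) (sum (suc n) (parity ∘ x))
        ≡⟨ cong₂ join (trans (code-cong n halves) code-b) sum≡ ⟩
      join ⌊ β /2⌋ (parity β)       ≡⟨ join-⌊/2⌋-parity β ⟩
      β                             ∎))
    where
    open ≡-Reasoning
    halves : ∀ {i} → i < suc n → ⌊ x i /2⌋ ≡ b i
    halves {i} i<n = decidable-stable (⌊ x i /2⌋ ≟ b i) λ ≢ → same (i , i<n , ≢)
  ... | yes (j , j<n , xj≢bj) = joinSeq b (toggle j opposite) , y⟂x ,
    color≡β (toggle j opposite) (begin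
      sum (suc n) (toggle j opposite)   ≡⟨ sum-toggle (suc n) j opposite j<n ⟩
      sum (suc n) opposite ⁻¹           ≡⟨ cong _⁻¹ sum-opposite ⟩
      sum (suc n) (parity ∘ x) ⁻¹ ⁻¹    ≡⟨ ⁻¹-involutive _ ⟩
      sum (suc n) (parity ∘ x)          ≡⟨ sum≡ ⟩
      parity β                          ∎)
    where
    open ≡-Reasoning
    y⟂x : joinSeq b (toggle j opposite) ⟂ x
    y⟂x i eq with i ≟ j
    ... | yes refl = xj≢bj (trans (cong ⌊_/2⌋ (sym eq)) (⌊join/2⌋ (b j) _))
    ... | no  i≢j  =
      join-≢ (b i) (x i) (trans (cong (join (b i)) (sym (toggle-≢ j opposite i i≢j))) eq)

-- Dependence on infinitely many coordinates

color-infinitary : ¬ DependsOnFinitelyMany coloring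
color-infinitary (S , determined) =
  -- With all halves equal to `k`, the last coordinate used is `j`, beyond `S`. A parity flip at `j`
  -- is invisible on `S` but inverts the sum.
  p≢p⁻¹ (sum (suc j) (const 0ℙ)) (join-injectiveʳ (begin
    join (code j (const k)) (sum (suc j) (const 0ℙ))
      ≡⟨ color-joinSeq (const k) (const 0ℙ) ⟨
    color (joinSeq (const k) (const 0ℙ))
      ≡⟨ determined _ _ (λ i i∈S →
           cong (join k) (sym (toggle-≢ j (const 0ℙ) i (i≢j i∈S)))) ⟩
    color (joinSeq (const k) (toggle j (const 0ℙ)))
      ≡⟨ color-joinSeq (const k) (toggle j (const 0ℙ)) ⟩
    join (code j (const k)) (sum (suc j) (toggle j (const 0ℙ)))
      ≡⟨ cong (join (code j (const k))) (sum-toggle (suc j) j (const 0ℙ) ≤-refl) ⟩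
    join (code j (const k)) (sum (suc j) (const 0ℙ) ⁻¹) ∎))
  where
  open ≡-Reasoning
  -- The default `0` covers an empty `S`; `j` is `2 * k + 2`, larger than every entry of `S`.
  k = max 0 S
  j = last k
  i≢j : ∀ {i} → i ∈ S → i ≢ j
  i≢j i∈S = <⇒≢ (≤-<-trans (All.lookup (xs≤max 0 S) i∈S)
                           (s≤s (m≤n⇒m≤1+n (m≤m+n k _))))

theorem7p14 : Σ[ F ∈ Coloring ] (IsProper F × IsTight F × ¬ DependsOnFinitelyMany F)
theorem7p14 = coloring , color-proper , color-tight , color-infinitary
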